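{- Let $p$ be an odd prime and $b\in\{0,2,4,\ldots\}$. Then the function $$f(k)=\left(1-\left(\frac p3\right)p^{k(p-1)+b}\right)U_{k(p-1)+b}\qquad(k=0,1,2,\ldots)$$ is a $p$-regular function.
   Context: $[x]$ is the greatest integer not exceeding $x$. The sequence $\{U_n\}_{n\ge0}$ is defined by $U_0=1$ and $U_n=-2\sum_{k=1}^{[n/2]}\binom n{2k}U_{n-2k}$ for $n\ge1$. $\left(\frac p3\right)$ is the Legendre symbol: it equals $0$, $1$, $-1$ according as $p\equiv0,1,2\pmod3$. $\mathbb Z_p$ is the ring of rational numbers whose denominator is coprime to $p$. For a prime $p$, a function $f$ on the nonnegative integers is called $p$-regular if $f(k)\in\mathbb Z_p$ for $k=0,1,2,\ldots$ and $\sum_{k=0}^n\binom nk(-1)^kf(k)\equiv0\pmod{p^n}$ for all positive integers $n$. -}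

module Defs where

open import Data.Fin.Base using (toℕ)
open import Data.Integer.Base as ℤ using (ℤ; +_; -[1+_]; 0ℤ; 1ℤ; -1ℤ)
import Data.Integer.Properties as ℤₚ
open import Data.Nat.Base using (ℕ; zero; suc; _+_; _*_; _∸_; _^_; _≤_; _<_; s≤s; ⌊_/2⌋)
open import Data.Nat.Combinatorics using (_C_)
open import Data.Nat.Coprimality using (Coprime)
open import Data.Nat.DivMod using (_%_)
open import Data.Nat.Induction using (<-wellFounded; <-rec)
open import Data.Nat.Properties using (m∸n≤m)
open import Data.Product.Base using (∃-syntax; _×_)
open import Data.Rational.Base as ℚ using (ℚ; 0ℚ; ↧ₙ_)
open import Data.Rational.Literals using (fromℤ)
import Data.Rational.Properties as ℚₚ
open import Induction.WellFounded using (module FixPoint)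
open import Relation.Binary.PropositionalEquality using (_≡_; refl; cong)

open import Algebra.Properties.Monoid.Sum ℤₚ.+-0-monoid using (sum-syntax; sum-cong-≗)
open import Algebra.Properties.Monoid.Sum ℚₚ.+-0-monoid using (sum⁺-syntax)

n∸2k<n : ∀ n k → suc n ∸ 2 * suc k < suc n
n∸2k<n n k = s≤s (m∸n≤m n (k + 1 * suc k))

-- The summation index k = 1, …, [n/2] is written k = suc (toℕ i) with
-- i : Fin ⌊ n /2⌋.  Since 2 ≤ 2k ≤ n in this range, ∸ is ordinary subtraction.
U-step : ∀ n → (∀ {m} → m < n → ℤ) → ℤ
U-step zero    _  = 1ℤ
U-step (suc n) U< =
  -[1+ 1 ] ℤ.* (∑[ i < ⌊ suc n /2⌋ ]
    (+ (suc n C (2 * suc (toℕ i))) ℤ.*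
     U< {suc n ∸ 2 * suc (toℕ i)} (n∸2k<n n (toℕ i))))

U : ℕ → ℤ
U = <-rec (λ _ → ℤ) U-step

U-zero : U 0 ≡ 1ℤ
U-zero = refl

U-step-ext : ∀ n {f g : ∀ {m} → m < n → ℤ} →
             (∀ {m} (m<n : m < n) → f m<n ≡ g m<n) → U-step n f ≡ U-step n g
U-step-ext zero    f≗g = refl
U-step-ext (suc n) f≗g =
  cong (-[1+ 1 ] ℤ.*_) (sum-cong-≗ {⌊ suc n /2⌋} (λ i →
    cong (+ (suc n C (2 * suc (toℕ i))) ℤ.*_) (f≗g (n∸2k<n n (toℕ i)))))

U-suc : ∀ n → U (suc n) ≡
  -[1+ 1 ] ℤ.* (∑[ i < ⌊ suc n /2⌋ ]
    (+ (suc n C (2 * suc (toℕ i))) ℤ.* U (suc n ∸ 2 * suc (toℕ i))))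
U-suc n = FixPoint.unfold-wfRec <-wellFounded (λ _ → ℤ) U-step U-step-ext {suc n}

-- The Legendre symbol (p/3).
legendre₃ : ℕ → ℤ
legendre₃ p with p % 3
... | 0 = 0ℤ
... | 1 = 1ℤ
... | _ = -1ℤ

-- x ∈ℤ₍ p ₎ is membership in ℤ_p, a subring of ℚ (not the p-adic integers);
-- elements of ℚ are stored in lowest terms, so ↧ₙ x is the reduced denominator.
_∈ℤ₍_₎ : ℚ → ℕ → Set
x ∈ℤ₍ p ₎ = Coprime (↧ₙ x) p

-- x ≡ y (mod m) in ℤ_p: the difference lies in the ideal m ℤ_p.
Congruent : (p m : ℕ) → ℚ → ℚ → Set
Congruent p m x y = ∃[ z ] (z ∈ℤ₍ p ₎ × x ℚ.- y ≡ fromℤ (+ m) ℚ.* z)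

Regular : ℕ → (ℕ → ℚ) → Set
Regular p f =
  (∀ k → f k ∈ℤ₍ p ₎) ×
  (∀ n → 1 ≤ n → Congruent p (p ^ n)
    (∑[ i ≤ n ] (fromℤ (+ (n C toℕ i) ℤ.* -1ℤ ℤ.^ toℕ i) ℚ.* f (toℕ i)))
    0ℚ)

-- Formally U(t) = 1 / (eᵗ + e⁻ᵗ - 1) = (eᵗ + e²ᵗ) / (1 + e³ᵗ), so U n is an
-- Abel sum of the series Σ χ(m) mⁿ, where χ(m + 3) = - χ(m) and χ takes the
-- values 0, 1, 1 at 0, 1, 2.  The rigorous form is the congruence
-- 2 U n ≡ Σ_{m < 3J} χ(m) mⁿ (mod J) for odd J, obtained by telescoping the
-- recurrence of the Appell polynomials (x + U)ⁿ.  As χ(p m) = (p/3) χ(m), the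
-- Euler factor 1 - (p/3) pⁿ deletes the terms with p ∣ m.  For p ∤ m the
-- alternating sum of m^(k(p-1)+b) is m^b (1 - m^(p-1))^N, which is divisible by
-- p^N by Fermat's little theorem.

module Submission where

open import Defs

module AlternatingPowerSums where
  open import Data.Empty using (⊥-elim)
  open import Data.Fin.Base using (toℕ)
  open import Data.Integer.Base hiding (suc)
  open import Data.Integer.Divisibility.Signed
  open import Data.Integer.Properties
  open import Data.Integer.Tactic.RingSolver using (solve-∀)
  open import Data.Nat.Base as ℕ using (ℕ; zero; suc; ⌊_/2⌋)
  open import Data.Nat.Combinatorics using (_C_; nCk+nC[k+1]≡[n+1]C[k+1]; k>n⇒nCk≡0; nC1≡n; nCn≡1)
  import Data.Nat.Divisibility as ℕ
  open import Data.Nat.Primality using (Prime; euclidsLemma)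
  import Data.Nat.Properties as ℕ
  open import Data.Product.Base using (∃-syntax; _,_)
  open import Data.Sum.Base using (inj₁; inj₂)
  open import Function.Base using (_∘_)
  open import Relation.Binary.PropositionalEquality
  open import Relation.Nullary.Decidable using (yes; no)
  open import Relation.Nullary.Negation using (¬_)
  open import Algebra.Properties.CommutativeMonoid.Sum +-0-commutativeMonoid
    using (sum-syntax; sum-cong-≗; ∑-distrib-+)
  open import Algebra.Properties.CommutativeSemigroup +-commutativeSemigroup
    using (interchange; x∙yz≈y∙xz)
  open import Algebra.Properties.CommutativeSemigroup *-commutativeSemigroup
    using () renaming (interchange to *-interchange)
  open import Algebra.Properties.Semiring.Sum +-*-semiring using (*-distribˡ-sum)
  open ≡-Reasoning

  -- Finite sums over initial segments of ℕ.

  ∑< : ℕ → (ℕ → ℤ) → ℤ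
  ∑< n F = ∑[ i < n ] F (toℕ i)

  ∑<-cong : ∀ n {F G : ℕ → ℤ} → F ≗ G → ∑< n F ≡ ∑< n G
  ∑<-cong n F≗G = sum-cong-≗ {n} (F≗G ∘ toℕ)

  ∑<-+ : ∀ n (F G : ℕ → ℤ) → ∑< n (λ k → F k + G k) ≡ ∑< n F + ∑< n G
  ∑<-+ n F G = ∑-distrib-+ {n} (F ∘ toℕ) (G ∘ toℕ)

  ∑<-*ˡ : ∀ n c (F : ℕ → ℤ) → ∑< n (λ k → c * F k) ≡ c * ∑< n F
  ∑<-*ˡ n c F = sym (*-distribˡ-sum {n} c (F ∘ toℕ))

  ∑<-last : ∀ n (F : ℕ → ℤ) → ∑< (suc n) F ≡ ∑< n F + F n
  ∑<-last zero    F = +-comm (F 0) 0ℤ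
  ∑<-last (suc n) F = begin
    F 0 + ∑< (suc n) (F ∘ suc)         ≡⟨ cong (λ z → F 0 + z) (∑<-last n (F ∘ suc)) ⟩
    F 0 + (∑< n (F ∘ suc) + F (suc n)) ≡⟨ +-assoc (F 0) _ _ ⟨
    F 0 + ∑< n (F ∘ suc) + F (suc n)   ∎

  ∑<-split : ∀ m n (F : ℕ → ℤ) → ∑< (m ℕ.+ n) F ≡ ∑< m F + ∑< n (F ∘ (m ℕ.+_))
  ∑<-split zero    n F = sym (+-identityˡ _)
  ∑<-split (suc m) n F =
    trans (cong (λ z → F 0 + z) (∑<-split m n (F ∘ suc))) (sym (+-assoc (F 0) _ _))

  -- Brings a full binomial sum, whose odd terms cancel, to the range in the recurrence of `U`
  -- together with the index 0.
  ∑<-even : ∀ n (F : ℕ → ℤ) → (∀ k → F (suc (2 ℕ.* k)) ≡ 0ℤ) →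
            ∑< (suc n) F ≡ ∑< (suc ⌊ n /2⌋) (λ k → F (2 ℕ.* k))
  ∑<-even zero          F F-odd = refl
  ∑<-even (suc zero)    F F-odd = cong (λ x → F 0 + (x + 0ℤ)) (F-odd 0)
  ∑<-even (suc (suc n)) F F-odd = begin
    F 0 + (F 1 + ∑< (suc n) F′)
      ≡⟨ cong (λ x → F 0 + (x + ∑< (suc n) F′)) (F-odd 0) ⟩
    F 0 + (0ℤ + ∑< (suc n) F′)
      ≡⟨ cong (λ z → F 0 + z) (+-identityˡ _) ⟩
    F 0 + ∑< (suc n) F′
      ≡⟨ cong (λ z → F 0 + z) (∑<-even n F′ λ k → trans (cong (F ∘ suc) (sym (ℕ.*-suc 2 k))) (F-odd (suc k))) ⟩
    F 0 + ∑< (suc ⌊ n /2⌋) (λ k → F′ (2 ℕ.* k))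
      ≡⟨ cong (λ z → F 0 + z) (∑<-cong (suc ⌊ n /2⌋) λ k → cong F (sym (ℕ.*-suc 2 k))) ⟩
    F 0 + ∑< (suc ⌊ n /2⌋) (λ k → F (2 ℕ.* suc k)) ∎
    where
    F′ : ℕ → ℤ
    F′ k = F (2 ℕ.+ k)

  -- Each block of `suc q` indices gives up its first one. For `suc q` equal to p this separates the
  -- multiples of p from the other indices.
  ∑<-residues : ∀ M q (F : ℕ → ℤ) → ∑< (M ℕ.* suc q) F ≡
    ∑< M (λ j → F (j ℕ.* suc q)) + ∑< M (λ j → ∑< q (λ i → F (j ℕ.* suc q ℕ.+ suc i)))
  ∑<-residues zero    q F = refl
  ∑<-residues (suc M) q F = begin
    ∑< (suc q ℕ.+ M ℕ.* suc q) F
      ≡⟨ ∑<-split (suc q) (M ℕ.* suc q) F ⟩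
    F 0 + B + ∑< (M ℕ.* suc q) F′
      ≡⟨ cong (λ x → F 0 + B + x) (∑<-residues M q F′) ⟩
    F 0 + B + (A + ∑< M (λ j → ∑< q (λ i → F′ (j ℕ.* suc q ℕ.+ suc i))))
      ≡⟨ cong (λ x → F 0 + B + (A + x))
           (∑<-cong M λ j → ∑<-cong q λ i → cong F (sym (ℕ.+-assoc (suc q) (j ℕ.* suc q) (suc i)))) ⟩
    F 0 + B + (A + ∑< M (λ j → ∑< q (λ i → F (suc j ℕ.* suc q ℕ.+ suc i))))
      ≡⟨ interchange (F 0) B A _ ⟩
    F 0 + A + (B + ∑< M (λ j → ∑< q (λ i → F (suc j ℕ.* suc q ℕ.+ suc i)))) ∎
    where
    F′ : ℕ → ℤ
    F′ k = F (suc q ℕ.+ k)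
    A B : ℤ
    A = ∑< M (λ j → F′ (j ℕ.* suc q))
    B = ∑< q (λ i → F (suc i))

  ∣-∑< : ∀ {d} n (F : ℕ → ℤ) → (∀ k → k ℕ.< n → d ∣ F k) → d ∣ ∑< n F
  ∣-∑< zero    F d∣F = divides 0ℤ refl
  ∣-∑< (suc n) F d∣F =
    ∣m∣n⇒∣m+n (d∣F 0 (ℕ.s≤s ℕ.z≤n)) (∣-∑< n (F ∘ suc) λ k k<n → d∣F (suc k) (ℕ.s≤s k<n))

  -- Products of exponential generating functions.

  -- Sequences are read as exponential generating functions: ⊛ is their
  -- product, defined through the Leibniz rule since differentiation is _∘ suc.
  infixl 7 _⊛_
  _⊛_ : (ℕ → ℤ) → (ℕ → ℤ) → ℕ → ℤ
  (a ⊛ b) zero    = a 0 * b 0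
  (a ⊛ b) (suc n) = (a ∘ suc ⊛ b) n + (a ⊛ b ∘ suc) n

  ⊛-cong : ∀ {a a′ b b′} → a ≗ a′ → b ≗ b′ → a ⊛ b ≗ a′ ⊛ b′
  ⊛-cong a≗ b≗ zero    = cong₂ _*_ (a≗ 0) (b≗ 0)
  ⊛-cong a≗ b≗ (suc n) = cong₂ _+_ (⊛-cong (a≗ ∘ suc) b≗ n) (⊛-cong a≗ (b≗ ∘ suc) n)

  ⊛-comm : ∀ a b → a ⊛ b ≗ b ⊛ a
  ⊛-comm a b zero    = *-comm (a 0) (b 0)
  ⊛-comm a b (suc n) =
    trans (cong₂ _+_ (⊛-comm (a ∘ suc) b n) (⊛-comm a (b ∘ suc) n)) (+-comm ((b ⊛ a ∘ suc) n) _)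

  ⊛-distribʳ-+ : ∀ a a′ b n → ((λ k → a k + a′ k) ⊛ b) n ≡ (a ⊛ b) n + (a′ ⊛ b) n
  ⊛-distribʳ-+ a a′ b zero    = *-distribʳ-+ (b 0) (a 0) (a′ 0)
  ⊛-distribʳ-+ a a′ b (suc n) =
    trans (cong₂ _+_ (⊛-distribʳ-+ (a ∘ suc) (a′ ∘ suc) b n) (⊛-distribʳ-+ a a′ (b ∘ suc) n))
          (interchange ((a ∘ suc ⊛ b) n) ((a′ ∘ suc ⊛ b) n) _ _)

  ⊛-distribˡ-+ : ∀ a b b′ n → (a ⊛ (λ k → b k + b′ k)) n ≡ (a ⊛ b) n + (a ⊛ b′) n
  ⊛-distribˡ-+ a b b′ n =
    trans (⊛-comm a _ n)
      (trans (⊛-distribʳ-+ b b′ a n) (cong₂ _+_ (⊛-comm b a n) (⊛-comm b′ a n)))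

  ⊛-*ˡ : ∀ c a b n → ((λ k → c * a k) ⊛ b) n ≡ c * (a ⊛ b) n
  ⊛-*ˡ c a b zero    = *-assoc c (a 0) (b 0)
  ⊛-*ˡ c a b (suc n) =
    trans (cong₂ _+_ (⊛-*ˡ c (a ∘ suc) b n) (⊛-*ˡ c a (b ∘ suc) n)) (sym (*-distribˡ-+ c _ _))

  ⊛-*ʳ : ∀ c a b n → (a ⊛ (λ k → c * b k)) n ≡ c * (a ⊛ b) n
  ⊛-*ʳ c a b n = trans (⊛-comm a _ n) (trans (⊛-*ˡ c b a n) (cong (c *_) (⊛-comm b a n)))

  ⊛-assoc : ∀ a b c → a ⊛ b ⊛ c ≗ a ⊛ (b ⊛ c)
  ⊛-assoc a b c zero    = *-assoc (a 0) (b 0) (c 0)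
  ⊛-assoc a b c (suc n) = begin
    ((λ k → (a ∘ suc ⊛ b) k + (a ⊛ b ∘ suc) k) ⊛ c) n + (a ⊛ b ⊛ c ∘ suc) n
      ≡⟨ cong (_+ (a ⊛ b ⊛ c ∘ suc) n) (⊛-distribʳ-+ (a ∘ suc ⊛ b) (a ⊛ b ∘ suc) c n) ⟩
    (a ∘ suc ⊛ b ⊛ c) n + (a ⊛ b ∘ suc ⊛ c) n + (a ⊛ b ⊛ c ∘ suc) n
      ≡⟨ cong₂ _+_ (cong₂ _+_ (⊛-assoc (a ∘ suc) b c n) (⊛-assoc a (b ∘ suc) c n))
                   (⊛-assoc a b (c ∘ suc) n) ⟩
    (a ∘ suc ⊛ (b ⊛ c)) n + (a ⊛ (b ∘ suc ⊛ c)) n + (a ⊛ (b ⊛ c ∘ suc)) n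
      ≡⟨ +-assoc ((a ∘ suc ⊛ (b ⊛ c)) n) _ _ ⟩
    (a ∘ suc ⊛ (b ⊛ c)) n + ((a ⊛ (b ∘ suc ⊛ c)) n + (a ⊛ (b ⊛ c ∘ suc)) n)
      ≡⟨ cong (λ z → (a ∘ suc ⊛ (b ⊛ c)) n + z) (⊛-distribˡ-+ a (b ∘ suc ⊛ c) (b ⊛ c ∘ suc) n) ⟨
    (a ∘ suc ⊛ (b ⊛ c)) n + (a ⊛ (λ k → (b ∘ suc ⊛ c) k + (b ⊛ c ∘ suc) k)) n ∎

  ∣-⊛ : ∀ {d} a b → (∀ k → d ∣ a k) → ∀ n → d ∣ (a ⊛ b) n
  ∣-⊛ a b d∣a zero    = ∣m⇒∣m*n (b 0) (d∣a 0)
  ∣-⊛ a b d∣a (suc n) = ∣m∣n⇒∣m+n (∣-⊛ (a ∘ suc) b (d∣a ∘ suc) n) (∣-⊛ a (b ∘ suc) d∣a n)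

  -- This is e^(xt) e^(yt) = e^((x+y)t); the Leibniz form of `⊛` gives it by induction without
  -- binomial coefficients.
  ⊛-^ : ∀ x y n → ((x ^_) ⊛ (y ^_)) n ≡ (x + y) ^ n
  ⊛-^ x y zero    = refl
  ⊛-^ x y (suc n) = begin
    ((λ k → x * x ^ k) ⊛ (y ^_)) n + ((x ^_) ⊛ (λ k → y * y ^ k)) n
      ≡⟨ cong₂ _+_ (⊛-*ˡ x (x ^_) (y ^_) n) (⊛-*ʳ y (x ^_) (y ^_) n) ⟩
    x * ((x ^_) ⊛ (y ^_)) n + y * ((x ^_) ⊛ (y ^_)) n
      ≡⟨ *-distribʳ-+ _ x y ⟨
    (x + y) * ((x ^_) ⊛ (y ^_)) n
      ≡⟨ cong ((x + y) *_) (⊛-^ x y n) ⟩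
    (x + y) * (x + y) ^ n ∎

  -- `0ℤ ^_` is 1, 0, 0, ..., with generating function 1, since `0ℤ ^ 0` is 1.
  ⊛-identityˡ : ∀ a → (0ℤ ^_) ⊛ a ≗ a
  ⊛-identityˡ a zero    = *-identityˡ (a 0)
  ⊛-identityˡ a (suc n) =
    trans (cong₂ _+_ (⊛-*ˡ 0ℤ (0ℤ ^_) a n) (⊛-identityˡ (a ∘ suc) n)) (+-identityˡ _)

  -- Pascal's rule turns the Leibniz rule into explicit coefficients, needed wherever `_C_` occurs:
  -- in the recurrence of `U`, in Fermat's theorem and in regularity.
  ⊛-binomial : ∀ a b n →
    (a ⊛ b) n ≡ ∑< (suc n) (λ k → + (n C k) * (a k * b (n ℕ.∸ k)))
  ⊛-binomial a b zero    = sym (trans (+-identityʳ _) (*-identityˡ _))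
  ⊛-binomial a b (suc n) = begin
    (a ∘ suc ⊛ b) n + (a ⊛ b ∘ suc) n
      ≡⟨ cong₂ _+_ (⊛-binomial (a ∘ suc) b n) (⊛-binomial a (b ∘ suc) n) ⟩
    ∑< (suc n) F + ∑< (suc n) (λ k → + (n C k) * (a k * b (suc (n ℕ.∸ k))))
      ≡⟨ cong (λ z → ∑< (suc n) F + z) (∑<-cong (suc n) suc-∸) ⟩
    ∑< (suc n) F + ∑< (suc n) G
      ≡⟨ cong (λ z → ∑< (suc n) F + z) (sym last-G) ⟩
    ∑< (suc n) F + (G 0 + ∑< (suc n) (G ∘ suc))
      ≡⟨ x∙yz≈y∙xz (∑< (suc n) F) (G 0) _ ⟩
    G 0 + (∑< (suc n) F + ∑< (suc n) (G ∘ suc))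
      ≡⟨ cong (λ z → G 0 + z) (∑<-+ (suc n) F (G ∘ suc)) ⟨
    G 0 + ∑< (suc n) (λ k → F k + G (suc k))
      ≡⟨ cong (λ z → G 0 + z) (∑<-cong (suc n) pascal) ⟩
    H 0 + ∑< (suc n) (H ∘ suc) ∎
    where
    F G H : ℕ → ℤ
    F k = + (n C k) * (a (suc k) * b (n ℕ.∸ k))
    G k = + (n C k) * (a k * b (suc n ℕ.∸ k))
    H k = + (suc n C k) * (a k * b (suc n ℕ.∸ k))

    -- For k > n truncated subtraction can make the arguments of `b` differ, but there C(n,k) = 0.
    suc-∸ : ∀ k → + (n C k) * (a k * b (suc (n ℕ.∸ k))) ≡ G k
    suc-∸ k with k ℕ.≤? n
    ... | yes k≤n = cong (λ m → + (n C k) * (a k * b m)) (sym (ℕ.+-∸-assoc 1 k≤n))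
    ... | no  k≰n rewrite k>n⇒nCk≡0 (ℕ.≰⇒> k≰n) = refl

    -- The added term carries C(n,n+1) = 0; it lets `G ∘ suc` run over the same range as `F`.
    last-G : ∑< (suc (suc n)) G ≡ ∑< (suc n) G
    last-G = trans (∑<-last (suc n) G) (trans
      (cong (λ x → ∑< (suc n) G + + x * (a (suc n) * b (n ℕ.∸ n))) (k>n⇒nCk≡0 (ℕ.n<1+n n)))
      (+-identityʳ _))

    pascal : ∀ k → F k + G (suc k) ≡ H (suc k)
    pascal k = trans (sym (*-distribʳ-+ _ (+ (n C k)) (+ (n C suc k))))
      (cong (λ c → + c * (a (suc k) * b (n ℕ.∸ k))) (nCk+nC[k+1]≡[n+1]C[k+1] n k))

  -- The recurrence of `U` as an identity of generating functions.

  -1^2k : ∀ k → -1ℤ ^ (2 ℕ.* k) ≡ 1ℤ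
  -1^2k k = trans (sym (^-*-assoc -1ℤ 2 k)) (^-zeroˡ k)

  -- In generating functions, (e^t + e^(-t)) U(t) = U(t) + 1. The coefficients 1 + (-1)^k are 0 for
  -- odd k and 2 for even k, so the recurrence applies.
  U-egf : ∀ n → ((1ℤ ^_) ⊛ U) n + ((-1ℤ ^_) ⊛ U) n ≡ U n + 0ℤ ^ n
  U-egf zero    = refl
  U-egf (suc m) = begin
    ((1ℤ ^_) ⊛ U) n + ((-1ℤ ^_) ⊛ U) n
      ≡⟨ ⊛-distribʳ-+ (1ℤ ^_) (-1ℤ ^_) U n ⟨
    (c ⊛ U) n
      ≡⟨ ⊛-binomial c U n ⟩
    ∑< (suc n) (λ k → + (n C k) * (c k * U (n ℕ.∸ k)))
      ≡⟨ ∑<-even n (λ k → + (n C k) * (c k * U (n ℕ.∸ k))) odd-term ⟩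
    ∑< (suc ⌊ n /2⌋) (λ k → + (n C 2 ℕ.* k) * (c (2 ℕ.* k) * U (n ℕ.∸ 2 ℕ.* k)))
      ≡⟨ ∑<-cong (suc ⌊ n /2⌋) even-term ⟩
    ∑< (suc ⌊ n /2⌋) (λ k → + 2 * (+ (n C 2 ℕ.* k) * U (n ℕ.∸ 2 ℕ.* k)))
      ≡⟨ ∑<-*ˡ (suc ⌊ n /2⌋) (+ 2) (λ k → + (n C 2 ℕ.* k) * U (n ℕ.∸ 2 ℕ.* k)) ⟩
    + 2 * (1ℤ * U n + S)
      ≡⟨ regroup (U n) S ⟩
    -- The recurrence is U n = -2 S, so the second bracket is zero.
    (U n + 0ℤ) + (U n - -[1+ 1 ] * S)
      ≡⟨ cong (λ u → (U n + 0ℤ) + (U n - u)) (U-suc m) ⟨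
    (U n + 0ℤ) + (U n - U n)
      ≡⟨ cong (λ z → U n + 0ℤ + z) (+-inverseʳ (U n)) ⟩
    (U n + 0ℤ) + 0ℤ
      ≡⟨ +-identityʳ _ ⟩
    U n + 0ℤ ∎
    where
    n : ℕ
    n = suc m
    c : ℕ → ℤ
    c k = 1ℤ ^ k + -1ℤ ^ k
    S : ℤ
    S = ∑< ⌊ n /2⌋ (λ k → + (n C 2 ℕ.* suc k) * U (n ℕ.∸ 2 ℕ.* suc k))

    odd-term : ∀ k → + (n C suc (2 ℕ.* k)) * (c (suc (2 ℕ.* k)) * U (n ℕ.∸ suc (2 ℕ.* k))) ≡ 0ℤ
    odd-term k rewrite ^-zeroˡ (2 ℕ.* k) | -1^2k k = *-zeroʳ (+ (n C suc (2 ℕ.* k)))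

    shuffle : ∀ x y → x * (+ 2 * y) ≡ + 2 * (x * y)
    shuffle = solve-∀

    even-term : ∀ k → + (n C 2 ℕ.* k) * (c (2 ℕ.* k) * U (n ℕ.∸ 2 ℕ.* k)) ≡
                      + 2 * (+ (n C 2 ℕ.* k) * U (n ℕ.∸ 2 ℕ.* k))
    even-term k = trans
      (cong (λ x → + (n C 2 ℕ.* k) * (x * U (n ℕ.∸ 2 ℕ.* k))) (cong₂ _+_ (^-zeroˡ (2 ℕ.* k)) (-1^2k k)))
      (shuffle (+ (n C 2 ℕ.* k)) _)

    regroup : ∀ u s → + 2 * (1ℤ * u + s) ≡ (u + 0ℤ) + (u - -[1+ 1 ] * s)
    regroup = solve-∀

  -- Appell polynomials and their telescoping.

  -- The polynomial (x + U)ⁿ = Σₖ C(n,k) U_{n-k} xᵏ, with generating function e^{xt} U(t).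
  appell : ℤ → ℕ → ℤ
  appell x = (x ^_) ⊛ U

  -- `U-egf` multiplied by e^((y+1)t): from the centre y + 1, the factors e^t and e^(-t) lead to y +
  -- 2 and y.
  appell-step : ∀ y n →
    appell (y + + 2) n + appell y n ≡ appell (y + 1ℤ) n + (y + 1ℤ) ^ n
  appell-step y n = begin
    appell (y + + 2) n + appell y n
      ≡⟨ cong₂ _+_ (shift 1ℤ (y + + 2) (up y)) (shift -1ℤ y (down y)) ⟩
    (e ⊛ ((1ℤ ^_) ⊛ U)) n + (e ⊛ ((-1ℤ ^_) ⊛ U)) n
      ≡⟨ ⊛-distribˡ-+ e ((1ℤ ^_) ⊛ U) ((-1ℤ ^_) ⊛ U) n ⟨
    (e ⊛ (λ k → ((1ℤ ^_) ⊛ U) k + ((-1ℤ ^_) ⊛ U) k)) n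
      ≡⟨ ⊛-cong {e} (λ _ → refl) U-egf n ⟩
    (e ⊛ (λ k → U k + 0ℤ ^ k)) n
      ≡⟨ ⊛-distribˡ-+ e U (0ℤ ^_) n ⟩
    (e ⊛ U) n + (e ⊛ (0ℤ ^_)) n
      ≡⟨ cong (λ z → (e ⊛ U) n + z) (trans (⊛-comm e (0ℤ ^_) n) (⊛-identityˡ e n)) ⟩
    (e ⊛ U) n + e n ∎
    where
    e : ℕ → ℤ
    e = (y + 1ℤ) ^_
    up : ∀ y → y + 1ℤ + 1ℤ ≡ y + + 2
    up = solve-∀
    down : ∀ y → y + 1ℤ + -1ℤ ≡ y
    down = solve-∀
    shift : ∀ s z → y + 1ℤ + s ≡ z → appell z n ≡ (e ⊛ ((s ^_) ⊛ U)) n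
    shift s _ refl = trans (⊛-cong (λ k → sym (⊛-^ (y + 1ℤ) s k)) (λ _ → refl) n)
                           (⊛-assoc e (s ^_) U n)

  -- With z the shift x ↦ x + 1, `appell-step` is the action of z² - z + 1, and (z + 1)(z² - z + 1)
  -- = z³ + 1: adding the relations at x and x + 1 cancels the middle values.
  appell-step₃ : ∀ x n →
    appell x n ≡ (x + 1ℤ) ^ n + (x + + 2) ^ n - appell (x + + 3) n
  appell-step₃ x n = combine (appell x n) (appell (x + 1ℤ) n) (appell (x + + 2) n) (appell (x + + 3) n)
    ((x + 1ℤ) ^ n) ((x + + 2) ^ n) (appell-step x n) (begin
    appell (x + + 3) n + appell (x + 1ℤ) n
      ≡⟨ cong (λ z → appell z n + appell (x + 1ℤ) n) (1+2 x) ⟨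
    appell (x + 1ℤ + + 2) n + appell (x + 1ℤ) n
      ≡⟨ appell-step (x + 1ℤ) n ⟩
    appell (x + 1ℤ + 1ℤ) n + (x + 1ℤ + 1ℤ) ^ n
      ≡⟨ cong (λ z → appell z n + z ^ n) (1+1 x) ⟩
    appell (x + + 2) n + (x + + 2) ^ n ∎)
    where
    1+1 : ∀ x → x + 1ℤ + 1ℤ ≡ x + + 2
    1+1 = solve-∀
    1+2 : ∀ x → x + 1ℤ + + 2 ≡ x + + 3
    1+2 = solve-∀
    rearrange : ∀ a₀ a₁ a₂ a₃ → a₀ ≡ (a₂ + a₀ - a₁) + (a₃ + a₁ - a₂) - a₃
    rearrange = solve-∀
    cancel : ∀ a x → a + x - a ≡ x
    cancel = solve-∀
    combine : ∀ a₀ a₁ a₂ a₃ x₁ x₂ → a₂ + a₀ ≡ a₁ + x₁ → a₃ + a₁ ≡ a₂ + x₂ →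
              a₀ ≡ x₁ + x₂ - a₃
    combine a₀ a₁ a₂ a₃ x₁ x₂ p q = trans (rearrange a₀ a₁ a₂ a₃)
      (cong (_- a₃) (cong₂ _+_ (trans (cong (_- a₁) p) (cancel a₁ x₁))
                               (trans (cong (_- a₂) q) (cancel a₂ x₂))))

  -- This is (-1)^(m-1) (m/3), of period 6 with values 0, 1, 1, 0, -1, -1.
  χ : ℕ → ℤ
  χ 0 = 0ℤ
  χ 1 = 1ℤ
  χ 2 = 1ℤ
  χ (suc (suc (suc m))) = - χ m

  χ-sum : ℕ → ℕ → ℤ
  χ-sum M n = ∑< M (λ m → χ m * (+ m) ^ n)

  -- Iterates `appell-step₃`. The base point is general because each step moves it by 3, and the
  -- sign of each step is that of χ(m + 3) = -χ(m).
  appell-telescope : ∀ J x n → appell x n ≡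
    ∑< (J ℕ.* 3) (λ m → χ m * (x + + m) ^ n) + -1ℤ ^ J * appell (x + + (J ℕ.* 3)) n
  appell-telescope zero x n = sym (trans (+-identityˡ _) (trans (*-identityˡ _)
    (cong (λ z → appell z n) (+-identityʳ x))))
  appell-telescope (suc J) x n = begin
    appell x n
      ≡⟨ appell-step₃ x n ⟩
    (x + 1ℤ) ^ n + (x + + 2) ^ n - appell (x + + 3) n
      ≡⟨ cong (λ z → (x + 1ℤ) ^ n + (x + + 2) ^ n - z) (appell-telescope J (x + + 3) n) ⟩
    (x + 1ℤ) ^ n + (x + + 2) ^ n - (T + s * appell (x + + 3 + + (J ℕ.* 3)) n)
      ≡⟨ cong (λ z → (x + 1ℤ) ^ n + (x + + 2) ^ n - (T + s * appell z n)) (+-assoc x (+ 3) (+ (J ℕ.* 3))) ⟩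
    (x + 1ℤ) ^ n + (x + + 2) ^ n - (T + s * W)
      ≡⟨ rearrange ((x + 1ℤ) ^ n) ((x + + 2) ^ n) T s W ((x + 0ℤ) ^ n) ⟩
    -- The zero term for m = 0 is inserted to match the unfolding of the first three indices.
    0ℤ * (x + 0ℤ) ^ n + (1ℤ * (x + 1ℤ) ^ n + (1ℤ * (x + + 2) ^ n + -1ℤ * T)) + -1ℤ * s * W
      ≡⟨ cong (λ z → 0ℤ * (x + 0ℤ) ^ n + (1ℤ * (x + 1ℤ) ^ n + (1ℤ * (x + + 2) ^ n + z)) + -1ℤ * s * W)
           (trans (sym (∑<-*ˡ (J ℕ.* 3) -1ℤ (λ m → χ m * (x + + 3 + + m) ^ n))) (∑<-cong (J ℕ.* 3) shift)) ⟩
    ∑< (suc J ℕ.* 3) (λ m → χ m * (x + + m) ^ n) + -1ℤ * s * W ∎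
    where
    s T W : ℤ
    s = -1ℤ ^ J
    T = ∑< (J ℕ.* 3) (λ m → χ m * (x + + 3 + + m) ^ n)
    W = appell (x + + (suc J ℕ.* 3)) n
    rearrange : ∀ a b t s w z → a + b - (t + s * w) ≡ 0ℤ * z + (1ℤ * a + (1ℤ * b + -1ℤ * t)) + -1ℤ * s * w
    rearrange = solve-∀
    negate : ∀ c z → -1ℤ * (c * z) ≡ - c * z
    negate = solve-∀
    shift : ∀ m → -1ℤ * (χ m * (x + + 3 + + m) ^ n) ≡ - χ m * (x + + (3 ℕ.+ m)) ^ n
    shift m = trans (negate (χ m) _) (cong (λ z → - χ m * z ^ n) (+-assoc x (+ 3) (+ m)))

  -- The coefficients of e^(xt) - 1 are divisible by d: the one at 0 is 1 - 1, the others contain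
  -- the factor x.
  appell-mod : ∀ {d x} → d ∣ x → ∀ n → d ∣ appell x n - U n
  appell-mod {d} {x} d∣x n = subst (d ∣_) eq (∣-⊛ δ U d∣δ n)
    where
    δ : ℕ → ℤ
    δ k = x ^ k + -1ℤ * 0ℤ ^ k
    d∣δ : ∀ k → d ∣ δ k
    d∣δ zero    = divides 0ℤ refl
    d∣δ (suc k) = subst (d ∣_) (sym (+-identityʳ _)) (∣m⇒∣m*n (x ^ k) d∣x)
    minus : ∀ a b → a + -1ℤ * b ≡ a - b
    minus = solve-∀
    eq : (δ ⊛ U) n ≡ appell x n - U n
    eq = begin
      (δ ⊛ U) n
        ≡⟨ ⊛-distribʳ-+ (x ^_) (λ k → -1ℤ * 0ℤ ^ k) U n ⟩
      appell x n + ((λ k → -1ℤ * 0ℤ ^ k) ⊛ U) n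
        ≡⟨ cong (λ z → appell x n + z) (⊛-*ˡ -1ℤ (0ℤ ^_) U n) ⟩
      appell x n + -1ℤ * appell 0ℤ n
        ≡⟨ cong (λ z → appell x n + -1ℤ * z) (⊛-identityˡ U n) ⟩
      appell x n + -1ℤ * U n
        ≡⟨ minus (appell x n) (U n) ⟩
      appell x n - U n ∎

  -- For odd J, telescoping from 0 gives U_n = S - A, with S the χ-sum and A the Appell value at 3J,
  -- and A ≡ U_n (mod J).
  U-χ-sum : ∀ J n → -1ℤ ^ J ≡ -1ℤ → + J ∣ U n + U n - χ-sum (J ℕ.* 3) n
  U-χ-sum J n odd = subst (+ J ∣_) eq (∣m⇒∣-m (appell-mod (divides (+ 3) (trans (cong +_ (ℕ.*-comm J 3)) (pos-* 3 J))) n))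
    where
    W : ℤ
    W = appell (+ (J ℕ.* 3)) n
    telescope : U n ≡ χ-sum (J ℕ.* 3) n + -1ℤ * W
    telescope = begin
      U n          ≡⟨ ⊛-identityˡ U n ⟨
      appell 0ℤ n  ≡⟨ appell-telescope J 0ℤ n ⟩
      ∑< (J ℕ.* 3) (λ m → χ m * (0ℤ + + m) ^ n) + -1ℤ ^ J * appell (0ℤ + + (J ℕ.* 3)) n
        ≡⟨ cong₂ (λ s y → ∑< (J ℕ.* 3) (λ m → χ m * (0ℤ + + m) ^ n) + s * appell y n)
             odd (+-identityˡ (+ (J ℕ.* 3))) ⟩
      ∑< (J ℕ.* 3) (λ m → χ m * (0ℤ + + m) ^ n) + -1ℤ * W
        ≡⟨ cong (_+ -1ℤ * W) (∑<-cong (J ℕ.* 3) λ m → cong (λ z → χ m * z ^ n) (+-identityˡ (+ m))) ⟩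
      χ-sum (J ℕ.* 3) n + -1ℤ * W ∎
    rearrange : ∀ s w u → - (w - u) ≡ (s + -1ℤ * w) + u - s
    rearrange = solve-∀
    eq : - (W - U n) ≡ U n + U n - χ-sum (J ℕ.* 3) n
    eq = trans (rearrange (χ-sum (J ℕ.* 3) n) W (U n))
      (cong (λ z → z + U n - χ-sum (J ℕ.* 3) n) (sym telescope))

  -- Signs, and the character at multiples of an odd number.

  -1*[-1*i]≡i : ∀ i → -1ℤ * (-1ℤ * i) ≡ i
  -1*[-1*i]≡i = solve-∀

  -1^odd : ∀ p → ¬ (2 ℕ.∣ p) → -1ℤ ^ p ≡ -1ℤ
  -1^odd zero          p-odd = ⊥-elim (p-odd (ℕ.divides 0 refl))
  -1^odd (suc zero)    p-odd = refl
  -1^odd (suc (suc p)) p-odd = trans (-1*[-1*i]≡i (-1ℤ ^ p))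
    (-1^odd p (λ 2∣p → p-odd (ℕ.∣m∣n⇒∣m+n ℕ.∣-refl 2∣p)))

  -1^odd^ : ∀ p N → ¬ (2 ℕ.∣ p) → -1ℤ ^ (p ℕ.^ N) ≡ -1ℤ
  -1^odd^ p zero    p-odd = refl
  -1^odd^ p (suc N) p-odd = trans (sym (^-*-assoc -1ℤ p (p ℕ.^ N)))
    (trans (cong (_^ (p ℕ.^ N)) (-1^odd p p-odd)) (-1^odd^ p N p-odd))

  χ-period : ∀ k m → χ (k ℕ.* 6 ℕ.+ m) ≡ χ m
  χ-period zero    m = refl
  χ-period (suc k) m = trans (neg-involutive _) (χ-period k m)

  χ-*3 : ∀ m → χ (m ℕ.* 3) ≡ 0ℤ
  χ-*3 zero    = refl
  χ-*3 (suc m) = cong -_ (χ-*3 m)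

  χ-*5 : ∀ m → χ (m ℕ.* 5) ≡ - χ m
  χ-*5 0 = refl
  χ-*5 1 = refl
  χ-*5 2 = refl
  χ-*5 (suc (suc (suc m))) =
    trans (neg-involutive (- - - χ (m ℕ.* 5)))
      (trans (neg-involutive (- χ (m ℕ.* 5))) (cong -_ (χ-*5 m)))

  -- Both sides depend on p only modulo 6, and oddness leaves the residues 1, 3, 5.
  χ-legendre₃ : ∀ p → ¬ (2 ℕ.∣ p) → ∀ m → χ (m ℕ.* p) ≡ legendre₃ p * χ m
  χ-legendre₃ 0 p-odd m = ⊥-elim (p-odd (ℕ.divides 0 refl))
  χ-legendre₃ 1 p-odd m = trans (cong χ (ℕ.*-identityʳ m)) (sym (*-identityˡ (χ m)))
  χ-legendre₃ 2 p-odd m = ⊥-elim (p-odd (ℕ.divides 1 refl))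
  χ-legendre₃ 3 p-odd m = χ-*3 m
  χ-legendre₃ 4 p-odd m = ⊥-elim (p-odd (ℕ.divides 2 refl))
  χ-legendre₃ 5 p-odd m = trans (χ-*5 m) (sym (-1*i≡-i (χ m)))
  χ-legendre₃ (suc (suc (suc (suc (suc (suc p)))))) p-odd m = begin
    χ (m ℕ.* (6 ℕ.+ p))       ≡⟨ cong χ (ℕ.*-distribˡ-+ m 6 p) ⟩
    χ (m ℕ.* 6 ℕ.+ m ℕ.* p)   ≡⟨ χ-period m (m ℕ.* p) ⟩
    χ (m ℕ.* p)               ≡⟨ χ-legendre₃ p (λ 2∣p → p-odd (ℕ.∣m∣n⇒∣m+n (ℕ.divides 3 refl) 2∣p)) m ⟩
    -- `legendre₃ (6 + p)` computes to `legendre₃ p`.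
    legendre₃ p * χ m         ∎

  -- Fermat's little theorem.

  [k+1]*[n+1]C[k+1]≡[n+1]*nCk : ∀ n k → suc k ℕ.* (suc n C suc k) ≡ suc n ℕ.* (n C k)
  [k+1]*[n+1]C[k+1]≡[n+1]*nCk zero    zero    = refl
  [k+1]*[n+1]C[k+1]≡[n+1]*nCk zero    (suc k) = ℕ.*-zeroʳ k
  [k+1]*[n+1]C[k+1]≡[n+1]*nCk (suc n) zero    = begin
    1 ℕ.* ((2 ℕ.+ n) C 1)  ≡⟨ ℕ.*-identityˡ ((2 ℕ.+ n) C 1) ⟩
    (2 ℕ.+ n) C 1          ≡⟨ nC1≡n (2 ℕ.+ n) ⟩
    2 ℕ.+ n              ≡⟨ ℕ.*-identityʳ (2 ℕ.+ n) ⟨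
    (2 ℕ.+ n) ℕ.* 1      ∎
  [k+1]*[n+1]C[k+1]≡[n+1]*nCk (suc n) (suc k) = begin
    suc (suc k) ℕ.* (suc (suc n) C suc (suc k))
      ≡⟨ cong (suc (suc k) ℕ.*_) (nCk+nC[k+1]≡[n+1]C[k+1] (suc n) (suc k)) ⟨
    suc (suc k) ℕ.* (a ℕ.+ (suc n C suc (suc k)))
      ≡⟨ ℕ.*-distribˡ-+ (suc (suc k)) a _ ⟩
    a ℕ.+ suc k ℕ.* a ℕ.+ suc (suc k) ℕ.* (suc n C suc (suc k))
      ≡⟨ cong₂ (λ x y → a ℕ.+ x ℕ.+ y) ([k+1]*[n+1]C[k+1]≡[n+1]*nCk n k)
           ([k+1]*[n+1]C[k+1]≡[n+1]*nCk n (suc k)) ⟩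
    a ℕ.+ suc n ℕ.* (n C k) ℕ.+ suc n ℕ.* (n C suc k)
      ≡⟨ ℕ.+-assoc a (suc n ℕ.* (n C k)) _ ⟩
    a ℕ.+ (suc n ℕ.* (n C k) ℕ.+ suc n ℕ.* (n C suc k))
      ≡⟨ cong (a ℕ.+_) (ℕ.*-distribˡ-+ (suc n) (n C k) _) ⟨
    a ℕ.+ suc n ℕ.* ((n C k) ℕ.+ (n C suc k))
      ≡⟨ cong (λ x → a ℕ.+ suc n ℕ.* x) (nCk+nC[k+1]≡[n+1]C[k+1] n k) ⟩
    a ℕ.+ suc n ℕ.* a ∎
    where
    a : ℕ
    a = suc n C suc k

  -- By absorption p divides (k+1) C(p,k+1), but not k + 1, as 0 < k + 1 < p.
  p∣pC[k+1] : ∀ {q} → Prime (suc q) → ∀ k → k ℕ.< q → suc q ℕ.∣ suc q C suc k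
  p∣pC[k+1] {q} pr k k<q
    with euclidsLemma (suc k) (suc q C suc k) pr
           (ℕ.divides (q C k) (trans ([k+1]*[n+1]C[k+1]≡[n+1]*nCk q k) (ℕ.*-comm (suc q) (q C k))))
  ... | inj₁ p∣k+1 = ⊥-elim (ℕ.<⇒≱ (ℕ.s≤s k<q) (ℕ.∣⇒≤ p∣k+1))
  ... | inj₂ p∣C   = p∣C

  -- Induction on m through the expansion of (1 + m)^p, whose inner coefficients are divisible by p.
  fermat : ∀ {q} → Prime (suc q) → ∀ m → + suc q ∣ (+ m) ^ suc q - + m
  fermat {q} pr zero    = divides 0ℤ refl
  fermat {q} pr (suc m) = subst (+ suc q ∣_) eq (∣m∣n⇒∣m+n middle (fermat pr m))
    where
    p : ℕ
    p = suc q
    -- `G k` is the term of index k + 1: inner for k < q, and the last one for k = q.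
    G : ℕ → ℤ
    G k = + (p C suc k) * (1ℤ ^ suc k * (+ m) ^ (q ℕ.∸ k))
    middle : + p ∣ ∑< q G
    middle = ∣-∑< q G λ k k<q → ∣m⇒∣m*n (1ℤ ^ suc k * (+ m) ^ (q ℕ.∸ k)) (∣ᵤ⇒∣ {+ p} {+ (p C suc k)} (p∣pC[k+1] pr k k<q))
    last-term : G q ≡ 1ℤ
    last-term = begin
      + (p C p) * (1ℤ ^ p * (+ m) ^ (q ℕ.∸ q))
        ≡⟨ cong₂ (λ x y → + x * (1ℤ ^ p * (+ m) ^ y)) (nCn≡1 p) (ℕ.n∸n≡0 q) ⟩
      1ℤ * (1ℤ ^ p * 1ℤ) ≡⟨ cong (λ z → 1ℤ * (z * 1ℤ)) (^-zeroˡ p) ⟩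
      1ℤ ∎
    regroup : ∀ a b c → b + (a - c) ≡ 1ℤ * (1ℤ * a) + (b + 1ℤ) - (1ℤ + c)
    regroup = solve-∀
    eq : ∑< q G + ((+ m) ^ p - + m) ≡ (+ suc m) ^ p - + suc m
    eq = begin
      ∑< q G + ((+ m) ^ p - + m)
        ≡⟨ regroup ((+ m) ^ p) (∑< q G) (+ m) ⟩
      1ℤ * (1ℤ * (+ m) ^ p) + (∑< q G + 1ℤ) - + suc m
        ≡⟨ cong (λ z → 1ℤ * (1ℤ * (+ m) ^ p) + (∑< q G + z) - + suc m) last-term ⟨
      1ℤ * (1ℤ * (+ m) ^ p) + (∑< q G + G q) - + suc m
        ≡⟨ cong (λ z → 1ℤ * (1ℤ * (+ m) ^ p) + z - + suc m) (∑<-last q G) ⟨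
      1ℤ * (1ℤ * (+ m) ^ p) + ∑< p G - + suc m
        ≡⟨ cong (_- + suc m) (⊛-binomial (1ℤ ^_) ((+ m) ^_) p) ⟨
      ((1ℤ ^_) ⊛ ((+ m) ^_)) p - + suc m
        ≡⟨ cong (_- + suc m) (⊛-^ 1ℤ (+ m) p) ⟩
      (+ suc m) ^ p - + suc m ∎

  -- p divides m (m^q - 1); absolute values carry this to ℕ, where Euclid's lemma cancels m.
  fermat-unit : ∀ {q} → Prime (suc q) → ∀ m → ¬ (suc q ℕ.∣ m) → + suc q ∣ 1ℤ - (+ m) ^ q
  fermat-unit {q} pr m p∤m
    with euclidsLemma m ∣ (+ m) ^ q - 1ℤ ∣ pr
           (subst (suc q ℕ.∣_) (trans (cong ∣_∣ (factor (+ m) ((+ m) ^ q))) (abs-* (+ m) _))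
             (∣⇒∣ᵤ (fermat pr m)))
    where
    factor : ∀ x y → x * y - x ≡ x * (y - 1ℤ)
    factor = solve-∀
  ... | inj₁ p∣m = ⊥-elim (p∤m p∣m)
  ... | inj₂ p∣  = subst (+ suc q ∣_) (swap ((+ m) ^ q)) (∣m⇒∣-m (∣ᵤ⇒∣ {+ suc q} {(+ m) ^ q - 1ℤ} p∣))
    where
    swap : ∀ y → - (y - 1ℤ) ≡ 1ℤ - y
    swap = solve-∀

  -- Alternating binomial sums.

  -- The sum in the definition of regularity, encoded as a product with e^t so that linearity,
  -- divisibility and the geometric case come from `⊛`.
  altSum : (ℕ → ℤ) → ℕ → ℤ
  altSum F = (λ k → -1ℤ ^ k * F k) ⊛ (1ℤ ^_)

  altSum-binomial : ∀ F n → altSum F n ≡ ∑< (suc n) (λ k → + (n C k) * -1ℤ ^ k * F k)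
  altSum-binomial F n = trans (⊛-binomial (λ k → -1ℤ ^ k * F k) (1ℤ ^_) n)
    (∑<-cong (suc n) λ k → trans
      (cong (λ z → + (n C k) * (-1ℤ ^ k * F k * z)) (^-zeroˡ (n ℕ.∸ k)))
      (reassoc (+ (n C k)) (-1ℤ ^ k) (F k)))
    where
    reassoc : ∀ x y z → x * (y * z * 1ℤ) ≡ x * y * z
    reassoc = solve-∀

  altSum-cong : ∀ {F G : ℕ → ℤ} → F ≗ G → altSum F ≗ altSum G
  altSum-cong F≗G = ⊛-cong (λ k → cong (-1ℤ ^ k *_) (F≗G k)) (λ _ → refl)

  altSum-+ : ∀ F G n → altSum (λ k → F k + G k) n ≡ altSum F n + altSum G n
  altSum-+ F G n = trans
    (⊛-cong (λ k → *-distribˡ-+ (-1ℤ ^ k) (F k) (G k)) (λ _ → refl) n)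
    (⊛-distribʳ-+ (λ k → -1ℤ ^ k * F k) (λ k → -1ℤ ^ k * G k) (1ℤ ^_) n)

  -- The sign moves into the base, and e^(-xt) e^t = e^((1-x)t).
  altSum-geometric : ∀ c x n → altSum (λ k → c * x ^ k) n ≡ c * (1ℤ - x) ^ n
  altSum-geometric c x n = begin
    altSum (λ k → c * x ^ k) n
      ≡⟨ ⊛-cong absorb (λ _ → refl) n ⟩
    ((λ k → c * (- x) ^ k) ⊛ (1ℤ ^_)) n
      ≡⟨ ⊛-*ˡ c ((- x) ^_) (1ℤ ^_) n ⟩
    c * (((- x) ^_) ⊛ (1ℤ ^_)) n
      ≡⟨ cong (c *_) (⊛-^ (- x) 1ℤ n) ⟩
    c * (- x + 1ℤ) ^ n
      ≡⟨ cong (λ z → c * z ^ n) (+-comm (- x) 1ℤ) ⟩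
    c * (1ℤ - x) ^ n ∎
    where
    step : ∀ s c x y → -1ℤ * s * (c * (x * y)) ≡ - x * (s * (c * y))
    step = solve-∀
    commute : ∀ c x y → x * (c * y) ≡ c * (x * y)
    commute = solve-∀
    absorb : ∀ k → -1ℤ ^ k * (c * x ^ k) ≡ c * (- x) ^ k
    absorb zero    = *-identityˡ (c * 1ℤ)
    absorb (suc k) = trans (step (-1ℤ ^ k) c x (x ^ k))
      (trans (cong (- x *_) (absorb k)) (commute c (- x) ((- x) ^ k)))

  ∣-altSum : ∀ {d} F → (∀ k → d ∣ F k) → ∀ n → d ∣ altSum F n
  ∣-altSum F d∣F = ∣-⊛ _ (1ℤ ^_) λ k → ∣n⇒∣m*n (-1ℤ ^ k) (d∣F k)

  ∣-altSum-∑< : ∀ {d} M (F : ℕ → ℕ → ℤ) n → (∀ i → i ℕ.< M → d ∣ altSum (F i) n) →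
                d ∣ altSum (λ k → ∑< M (λ i → F i k)) n
  ∣-altSum-∑< zero    F n d∣F = ∣-altSum (λ _ → 0ℤ) (λ _ → divides 0ℤ refl) n
  ∣-altSum-∑< (suc M) F n d∣F =
    subst (_ ∣_) (sym (altSum-+ (F 0) (λ k → ∑< M (λ i → F (suc i) k)) n))
      (∣m∣n⇒∣m+n (d∣F 0 (ℕ.s≤s ℕ.z≤n))
        (∣-altSum-∑< M (F ∘ suc) n λ i i<M → d∣F (suc i) (ℕ.s≤s i<M)))

  -- Powers, and division by two modulo an odd number.

  pos-^ : ∀ m n → + (m ℕ.^ n) ≡ (+ m) ^ n
  pos-^ m zero    = refl
  pos-^ m (suc n) = trans (pos-* m (m ℕ.^ n)) (cong (+ m *_) (pos-^ m n))

  ^-distribʳ-* : ∀ x y n → (x * y) ^ n ≡ x ^ n * y ^ n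
  ^-distribʳ-* x y zero    = refl
  ^-distribʳ-* x y (suc n) = trans (cong (x * y *_) (^-distribʳ-* x y n))
    (*-interchange x y (x ^ n) (y ^ n))

  ^-∣-^ : ∀ {p x} → + p ∣ x → ∀ n → + (p ℕ.^ n) ∣ x ^ n
  ^-∣-^ p∣x zero    = divides 1ℤ refl
  ^-∣-^ {p} {x} p∣x@(divides r refl) (suc n) with ^-∣-^ {p} p∣x n
  ... | divides s eq = divides (r * s) (begin
    r * + p * (r * + p) ^ n       ≡⟨ cong (r * + p *_) eq ⟩
    r * + p * (s * + (p ℕ.^ n))   ≡⟨ *-interchange r (+ p) s (+ (p ℕ.^ n)) ⟩
    r * s * (+ p * + (p ℕ.^ n))   ≡⟨ cong (r * s *_) (pos-* p (p ℕ.^ n)) ⟨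
    r * s * + (p ℕ.* p ℕ.^ n)     ∎)

  odd⇒1+2h : ∀ J → -1ℤ ^ J ≡ -1ℤ → ∃[ h ] + J ≡ 1ℤ + (h + h)
  odd⇒1+2h zero          ()
  odd⇒1+2h (suc zero)    _   = 0ℤ , refl
  odd⇒1+2h (suc (suc J)) odd with odd⇒1+2h J (trans (sym (-1*[-1*i]≡i (-1ℤ ^ J))) odd)
  ... | h , eq = h + 1ℤ , trans (cong (λ z → + 2 + z) eq) (next h)
    where
    next : ∀ h → + 2 + (1ℤ + (h + h)) ≡ 1ℤ + (h + 1ℤ + (h + 1ℤ))
    next = solve-∀

  -- With J = 1 + 2h, x = Jx - h(2x). This removes the factor 2 from the congruences for 2U.
  ∣-halve : ∀ J → -1ℤ ^ J ≡ -1ℤ → ∀ x → + J ∣ x + x → + J ∣ x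
  ∣-halve J odd x J∣2x with odd⇒1+2h J odd
  ... | h , eq = subst (+ J ∣_) (trans (cong (λ z → z * x - h * (x + x)) eq) (bezout h x))
                   (∣m∣n⇒∣m-n (∣m⇒∣m*n x ∣-refl) (∣n⇒∣m*n h J∣2x))
    where
    bezout : ∀ h x → (1ℤ + (h + h)) * x - h * (x + x) ≡ x
    bezout = solve-∀

  -- The Euler factor and congruences modulo powers of p.

  module _ (q b : ℕ) (pr : Prime (suc q)) (p-odd : ¬ (2 ℕ.∣ suc q)) where
    private
      p : ℕ
      p = suc q
      e : ℕ → ℕ
      e k = k ℕ.* q ℕ.+ b

    eulerFactor : ℕ → ℤ
    eulerFactor n = 1ℤ - legendre₃ p * + (p ℕ.^ n)

    -- The terms of `χ-sum (M * p)` with m prime to p, written m = jp + i + 1 with i < p - 1.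
    unit-χ-sum : ℕ → ℕ → ℤ
    unit-χ-sum M n = ∑< M λ j → ∑< q λ i → χ (j ℕ.* p ℕ.+ suc i) * (+ (j ℕ.* p ℕ.+ suc i)) ^ n

    -- A multiple m = jp contributes (p/3) p^n χ(j) j^n, so the multiples form a scaled copy of the
    -- shorter sum.
    χ-sum-split : ∀ M n → χ-sum (M ℕ.* p) n ≡
      legendre₃ p * + (p ℕ.^ n) * χ-sum M n + unit-χ-sum M n
    χ-sum-split M n = trans (∑<-residues M q (λ m → χ m * (+ m) ^ n)) (cong (_+ unit-χ-sum M n)
      (trans (∑<-cong M multiple)
             (∑<-*ˡ M (legendre₃ p * + (p ℕ.^ n)) (λ m → χ m * (+ m) ^ n))))
      where
      shuffle : ∀ l c x y → l * c * (x * y) ≡ l * y * (c * x)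
      shuffle = solve-∀
      multiple : ∀ j → χ (j ℕ.* p) * (+ (j ℕ.* p)) ^ n ≡
                       legendre₃ p * + (p ℕ.^ n) * (χ j * (+ j) ^ n)
      multiple j = begin
        χ (j ℕ.* p) * (+ (j ℕ.* p)) ^ n
          ≡⟨ cong₂ (λ c z → c * z ^ n) (χ-legendre₃ p p-odd j) (pos-* j p) ⟩
        legendre₃ p * χ j * (+ j * + p) ^ n
          ≡⟨ cong (legendre₃ p * χ j *_) (^-distribʳ-* (+ j) (+ p) n) ⟩
        legendre₃ p * χ j * ((+ j) ^ n * (+ p) ^ n)
          ≡⟨ cong (λ z → legendre₃ p * χ j * ((+ j) ^ n * z)) (pos-^ p n) ⟨
        legendre₃ p * χ j * ((+ j) ^ n * + (p ℕ.^ n))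
          ≡⟨ shuffle (legendre₃ p) (χ j) ((+ j) ^ n) (+ (p ℕ.^ n)) ⟩
        legendre₃ p * + (p ℕ.^ n) * (χ j * (+ j) ^ n) ∎

    -- Subtracting (p/3) p^n times the congruence of length 3p^N from the one of length 3p^(N+1)
    -- cancels the multiples of p and produces the Euler factor.
    eulerFactor*U-mod : ∀ N n → let f = eulerFactor n * U n in
      + (p ℕ.^ N) ∣ f + f - unit-χ-sum (p ℕ.^ N ℕ.* 3) n
    eulerFactor*U-mod N n = subst (+ (p ℕ.^ N) ∣_) eq (∣m∣n⇒∣m-n
      -- The longer sum gives a congruence modulo p^(N+1), weakened here to p^N.
      (∣-trans (∣ᵤ⇒∣ {+ (p ℕ.^ N)} {+ (p ℕ.^ suc N)} (ℕ.divides p refl)) (U-χ-sum (p ℕ.^ suc N) n (-1^odd^ p (suc N) p-odd)))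
      (∣n⇒∣m*n l (U-χ-sum (p ℕ.^ N) n (-1^odd^ p N p-odd))))
      where
      l S T u : ℤ
      l = legendre₃ p * + (p ℕ.^ n)
      S = χ-sum (p ℕ.^ N ℕ.* 3) n
      T = unit-χ-sum (p ℕ.^ N ℕ.* 3) n
      u = U n
      reorder : p ℕ.^ suc N ℕ.* 3 ≡ p ℕ.^ N ℕ.* 3 ℕ.* p
      reorder = trans (ℕ.*-assoc p (p ℕ.^ N) 3) (ℕ.*-comm p (p ℕ.^ N ℕ.* 3))
      rearrange : ∀ l s t u → u + u - (l * s + t) - l * (u + u - s) ≡
                              (1ℤ - l) * u + (1ℤ - l) * u - t
      rearrange = solve-∀
      eq : u + u - χ-sum (p ℕ.^ suc N ℕ.* 3) n - l * (u + u - S) ≡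
           (1ℤ - l) * u + (1ℤ - l) * u - T
      eq = trans
        (cong (λ z → u + u - z - l * (u + u - S))
          (trans (cong (λ M → χ-sum M n) reorder) (χ-sum-split (p ℕ.^ N ℕ.* 3) n)))
        (rearrange l S T u)

    -- The range of m does not depend on k, so the alternating sum is taken term by term; each term
    -- is geometric in k with ratio m^(p-1).
    altSum-unit-χ-sum : ∀ N M → + (p ℕ.^ N) ∣ altSum (unit-χ-sum M ∘ e) N
    altSum-unit-χ-sum N M =
      ∣-altSum-∑< M (λ j k → ∑< q λ i → term (j ℕ.* p ℕ.+ suc i) k) N λ j _ →
      ∣-altSum-∑< q (λ i k → term (j ℕ.* p ℕ.+ suc i) k) N λ i i<q →
      ∣-term (j ℕ.* p ℕ.+ suc i) λ p∣m →
        -- If p divided jp + i + 1, then p ≤ i + 1 < p.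
        ℕ.<⇒≱ (ℕ.s≤s i<q) (ℕ.∣⇒≤ (ℕ.∣m+n∣m⇒∣n p∣m (ℕ.divides j refl)))
      where
      term : ℕ → ℕ → ℤ
      term m k = χ m * (+ m) ^ e k
      geometric : ∀ m k → term m k ≡ χ m * (+ m) ^ b * ((+ m) ^ q) ^ k
      geometric m k = begin
        χ m * (+ m) ^ (k ℕ.* q ℕ.+ b)
          ≡⟨ cong (λ j → χ m * (+ m) ^ j)
               (trans (ℕ.+-comm (k ℕ.* q) b) (cong (b ℕ.+_) (ℕ.*-comm k q))) ⟩
        χ m * (+ m) ^ (b ℕ.+ q ℕ.* k)
          ≡⟨ cong (χ m *_) (^-distribˡ-+-* (+ m) b (q ℕ.* k)) ⟩
        χ m * ((+ m) ^ b * (+ m) ^ (q ℕ.* k))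
          ≡⟨ *-assoc (χ m) ((+ m) ^ b) ((+ m) ^ (q ℕ.* k)) ⟨
        χ m * (+ m) ^ b * (+ m) ^ (q ℕ.* k)
          ≡⟨ cong (χ m * (+ m) ^ b *_) (^-*-assoc (+ m) q k) ⟨
        χ m * (+ m) ^ b * ((+ m) ^ q) ^ k ∎
      ∣-term : ∀ m → ¬ (p ℕ.∣ m) → + (p ℕ.^ N) ∣ altSum (term m) N
      ∣-term m p∤m = subst (+ (p ℕ.^ N) ∣_)
        (sym (trans (altSum-cong (geometric m) N)
                    (altSum-geometric (χ m * (+ m) ^ b) ((+ m) ^ q) N)))
        (∣n⇒∣m*n (χ m * (+ m) ^ b) (^-∣-^ {p} (fermat-unit pr m p∤m) N))

    -- 2f(k) is `T k` plus a multiple of p^N, with one range `M` for all k. So p^N divides the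
    -- alternating sum of 2f, and p^N is odd.
    altSum-eulerFactor*U : ∀ N → + (p ℕ.^ N) ∣ altSum (λ k → eulerFactor (e k) * U (e k)) N
    altSum-eulerFactor*U N = ∣-halve (p ℕ.^ N) (-1^odd^ p N p-odd) (altSum f N)
      (subst (+ (p ℕ.^ N) ∣_) eq (∣m∣n⇒∣m+n (altSum-unit-χ-sum N M)
        (∣-altSum (λ k → f k + f k - T k) (λ k → eulerFactor*U-mod N (e k)) N)))
      where
      M : ℕ
      M = p ℕ.^ N ℕ.* 3
      f T : ℕ → ℤ
      f k = eulerFactor (e k) * U (e k)
      T = unit-χ-sum M ∘ e
      cancel : ∀ t x → t + (x - t) ≡ x
      cancel = solve-∀
      eq : altSum T N + altSum (λ k → f k + f k - T k) N ≡ altSum f N + altSum f N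
      eq = begin
        altSum T N + altSum (λ k → f k + f k - T k) N
          ≡⟨ altSum-+ T (λ k → f k + f k - T k) N ⟨
        altSum (λ k → T k + (f k + f k - T k)) N
          ≡⟨ altSum-cong (λ k → cancel (T k) (f k + f k)) N ⟩
        altSum (λ k → f k + f k) N
          ≡⟨ altSum-+ f f N ⟩
        altSum f N + altSum f N ∎

open import Data.Integer.Base as ℤ using (+_; 1ℤ)
open import Data.Nat.Base using (ℕ; _+_; _*_; _∸_; _^_)
open import Data.Nat.Divisibility using (_∣_)
open import Data.Nat.Primality using (Prime)
open import Data.Rational.Literals using (fromℤ)
open import Relation.Nullary.Negation using (¬_)

open import Data.Empty using (⊥-elim)
open import Data.Fin.Base using (toℕ)
open import Data.Integer.Base using (ℤ; -1ℤ)
import Data.Integer.Divisibility.Signed as ℤ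
import Data.Integer.Properties as ℤ
open import Data.Nat.Base using (zero; suc)
open import Data.Nat.Combinatorics using (_C_)
open import Data.Nat.Coprimality using (1-coprimeTo)
import Data.Nat.Divisibility as ℕ
open import Data.Product.Base using (_,_)
open import Data.Rational.Base as ℚ using (0ℚ)
import Data.Rational.Properties as ℚ
import Data.Rational.Unnormalised.Base as ℚᵘ
import Data.Rational.Unnormalised.Properties as ℚᵘ
open import Function.Base using (_∘_)
open import Relation.Binary.PropositionalEquality
open import Algebra.Properties.Monoid.Sum ℚ.+-0-monoid using (sum-cong-≗) renaming (sum to sumℚ)
open AlternatingPowerSums

-- Passage from ℤ to ℚ.

fromℤ-homo-+ : ∀ i j → fromℤ (i ℤ.+ j) ≡ fromℤ i ℚ.+ fromℤ j
fromℤ-homo-+ i j = ℚ.toℚᵘ-injective (ℚᵘ.≃-trans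
  (ℚᵘ.*≡* (cong (ℤ._* 1ℤ) (sym (cong₂ ℤ._+_ (ℤ.*-identityʳ i) (ℤ.*-identityʳ j)))))
  (ℚᵘ.≃-sym (ℚ.toℚᵘ-homo-+ (fromℤ i) (fromℤ j))))

fromℤ-homo-* : ∀ i j → fromℤ (i ℤ.* j) ≡ fromℤ i ℚ.* fromℤ j
fromℤ-homo-* i j = ℚ.toℚᵘ-injective (ℚᵘ.≃-trans
  (ℚᵘ.*≡* refl)
  (ℚᵘ.≃-sym (ℚ.toℚᵘ-homo-* (fromℤ i) (fromℤ j))))

sum-fromℤ : ∀ n (F : ℕ → ℤ) → sumℚ {n} (λ i → fromℤ (F (toℕ i))) ≡ fromℤ (∑< n F)
sum-fromℤ zero    F = refl
sum-fromℤ (suc n) F = trans (cong (fromℤ (F 0) ℚ.+_) (sum-fromℤ n (F ∘ suc)))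
  (sym (fromℤ-homo-+ (F 0) (∑< n (F ∘ suc))))

altSum⇒Regular : ∀ p (F : ℕ → ℤ) → (∀ n → + (p ^ n) ℤ.∣ altSum F n) → Regular p (fromℤ ∘ F)
altSum⇒Regular p F p^n∣ = (λ _ → 1-coprimeTo p) , λ n _ → congruent n (p^n∣ n)
  where
  open ≡-Reasoning
  congruent : ∀ n → + (p ^ n) ℤ.∣ altSum F n → Congruent p (p ^ n)
    (sumℚ {suc n} λ i → fromℤ (+ (n C toℕ i) ℤ.* -1ℤ ℤ.^ toℕ i) ℚ.* fromℤ (F (toℕ i))) 0ℚ
  -- The integer cofactor `r`, of denominator 1, is the witness in ℤ_p.
  congruent n (ℤ.divides r eq) = fromℤ r , 1-coprimeTo p , (begin
    sumℚ {suc n} (λ i → fromℤ (c (toℕ i)) ℚ.* fromℤ (F (toℕ i))) ℚ.- 0ℚ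
      ≡⟨ ℚ.+-identityʳ _ ⟩
    sumℚ {suc n} (λ i → fromℤ (c (toℕ i)) ℚ.* fromℤ (F (toℕ i)))
      ≡⟨ sum-cong-≗ {suc n} (λ i → fromℤ-homo-* (c (toℕ i)) (F (toℕ i))) ⟨
    sumℚ {suc n} (λ i → fromℤ (c (toℕ i) ℤ.* F (toℕ i)))
      ≡⟨ sum-fromℤ (suc n) (λ k → c k ℤ.* F k) ⟩
    fromℤ (∑< (suc n) (λ k → c k ℤ.* F k))
      ≡⟨ cong fromℤ (altSum-binomial F n) ⟨
    fromℤ (altSum F n)
      ≡⟨ cong fromℤ (trans eq (ℤ.*-comm r (+ (p ^ n)))) ⟩
    fromℤ (+ (p ^ n) ℤ.* r)
      ≡⟨ fromℤ-homo-* (+ (p ^ n)) r ⟩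
    fromℤ (+ (p ^ n)) ℚ.* fromℤ r ∎)
    where
    c : ℕ → ℤ
    c k = + (n C k) ℤ.* -1ℤ ℤ.^ k

theorem4p2 : (p b : ℕ) → Prime p → ¬ (2 ∣ p) → 2 ∣ b →
    Regular p (λ k →
    fromℤ ((1ℤ ℤ.- legendre₃ p ℤ.* + (p ^ (k * (p ∸ 1) + b))) ℤ.* U (k * (p ∸ 1) + b)))
theorem4p2 zero    b pr p-odd _ = ⊥-elim (p-odd (ℕ.divides 0 refl))
-- `suc q ∸ 1` computes to `q`, so the exponents agree.
theorem4p2 (suc q) b pr p-odd _ =
  altSum⇒Regular (suc q)
    (λ k → (1ℤ ℤ.- legendre₃ (suc q) ℤ.* + (suc q ^ (k * q + b))) ℤ.* U (k * q + b))
    (altSum-eulerFactor*U q b pr p-odd)
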